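{- If a vertex-transitive graph $\Gamma$ has an efficient dominating set, then $\gamma_{\mathrm{all}}^\infty(\Gamma)=\gamma(\Gamma)$.
   Context: Graphs are finite, undirected and simple. A vertex $u$ dominates a vertex $w$ if $w=u$ or $w$ is adjacent to $u$. A dominating set is a set $D$ of vertices such that every vertex is dominated by at least one vertex of $D$; $\gamma(\Gamma)$ is the smallest size of a dominating set of $\Gamma$. An efficient dominating set (perfect code) is a set $D$ of vertices such that every vertex of the graph is dominated by exactly one vertex of $D$. Guards located at the vertices of a set $D$ (one guard per vertex) can reconfigure to a set $D'$ if there is a bijection $f:D\to D'$ such that for every $d\in D$, either $f(d)=d$ or $f(d)$ is adjacent to $d$. An eternal dominating configuration for $\Gamma$ is a nonempty collection $\mathcal D$ of subsets of $V(\Gamma)$, all of the same cardinality, such that for every $D_i\in\mathcal D$ and every vertex $w\notin D_i$ there is $D_j\in\mathcal D$ with $w\in D_j$ such that guards at $D_i$ can reconfigure to $D_j$. An eternal dominating set is a member of some eternal dominating configuration. The eternal domination number $\gamma_{\mathrm{all}}^\infty(\Gamma)$ is the smallest cardinality of an eternal dominating set. -}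

module Defs where

open import Data.Fin.Base using (Fin)
open import Data.Fin.Permutation using (Permutation′; _⟨$⟩ʳ_)
open import Data.Fin.Subset using (Subset; _∈_; _∉_; ∣_∣)
open import Data.List.Base using (List)
import Data.List.Membership.Propositional as List
open import Data.Nat.Base using (ℕ; _≤_)
open import Data.Product using (Σ-syntax; ∃; ∃-syntax; ∃!; _×_; proj₁)
open import Data.Sum.Base using (_⊎_)
open import Function.Bundles using (_⇔_; _⤖_; module Bijection)
open import Level using (0ℓ)
open import Relation.Binary.Core using (Rel)
open import Relation.Binary.Definitions using (Decidable; Irreflexive; Symmetric)
open import Relation.Binary.PropositionalEquality.Core using (_≡_)

-- Adjacency is required to be decidable because a finite graph is taken to be
-- finite data; classically this is no restriction.
record Graph (n : ℕ) : Set₁ where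
  field
    Adj    : Rel (Fin n) 0ℓ
    adj?   : Decidable Adj
    sym    : Symmetric Adj
    irrefl : Irreflexive _≡_ Adj

-- k is the smallest cardinality of a subset satisfying P.
IsMinimumCardinality : {n : ℕ} → (Subset n → Set) → ℕ → Set
IsMinimumCardinality P k =
  (∃[ D ] (P D × ∣ D ∣ ≡ k)) × (∀ D → P D → k ≤ ∣ D ∣)

module _ {n : ℕ} (Γ : Graph n) where
  open Graph Γ using (Adj)

  IsAutomorphism : Permutation′ n → Set
  IsAutomorphism π = ∀ u v → Adj u v ⇔ Adj (π ⟨$⟩ʳ u) (π ⟨$⟩ʳ v)

  VertexTransitive : Set
  VertexTransitive =
    ∀ u v → Σ[ π ∈ Permutation′ n ] (IsAutomorphism π × π ⟨$⟩ʳ u ≡ v)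

  Dominates : Rel (Fin n) 0ℓ
  Dominates u w = w ≡ u ⊎ Adj w u

  IsDominatingSet : Subset n → Set
  IsDominatingSet D = ∀ w → ∃[ u ] (u ∈ D × Dominates u w)

  IsEfficientDominatingSet : Subset n → Set
  IsEfficientDominatingSet D = ∀ w → ∃! _≡_ λ u → u ∈ D × Dominates u w

  -- Membership proofs in a Subset are unique, so ∃ (_∈ D) has exactly one
  -- element for each vertex of D.
  CanReconfigure : Rel (Subset n) 0ℓ
  CanReconfigure D D′ =
    Σ[ f ∈ (∃ (_∈ D) ⤖ ∃ (_∈ D′)) ]
      (∀ d → let fd = Bijection.to f d in
             proj₁ fd ≡ proj₁ d ⊎ Adj (proj₁ fd) (proj₁ d))

  -- A collection of subsets is given by a list; only membership in the list
  -- is used, so order and repetitions are irrelevant.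
  record IsEternalDominatingConfiguration (𝒟 : List (Subset n)) : Set where
    field
      nonempty        : ∃[ D ] D List.∈ 𝒟
      sameCardinality : ∀ {D E} → D List.∈ 𝒟 → E List.∈ 𝒟 → ∣ D ∣ ≡ ∣ E ∣
      defends         : ∀ {D} → D List.∈ 𝒟 → ∀ {w} → w ∉ D →
                        ∃[ E ] (E List.∈ 𝒟 × w ∈ E × CanReconfigure D E)

  IsEternalDominatingSet : Subset n → Set
  IsEternalDominatingSet D =
    ∃[ 𝒟 ] (IsEternalDominatingConfiguration 𝒟 × D List.∈ 𝒟)

  IsDominationNumber : ℕ → Set
  IsDominationNumber = IsMinimumCardinality IsDominatingSet

  IsEternalDominationNumber : ℕ → Set
  IsEternalDominationNumber = IsMinimumCardinality IsEternalDominatingSet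

{-# OPTIONS --safe #-}

-- Let D be efficient and E dominating. Sending each vertex of D to a vertex of E that
-- dominates it is injective, since domination is symmetric, so |D| = γ. If E is efficient
-- too, the map is a bijection, i.e. a reconfiguration of guards. So any two efficient
-- dominating sets reconfigure to one another, and by vertex-transitivity every vertex lies
-- in an automorphic image of D.
module Submission where

open import Defs
open import Data.Fin.Permutation using (Permutation′; _⟨$⟩ʳ_; _⟨$⟩ˡ_; inverseˡ; inverseʳ)
open import Data.Fin.Properties using (suc-injective)
open import Data.Fin.Subset using (Subset; inside; outside; _∈_; ∣_∣; _-_)
open import Data.Fin.Subset.Properties using (_∈?_; x∈p⇒∣p-x∣<∣p∣; x∈p∧x≢y⇒x∈p-y)
open import Data.List.Base as List using (List)
import Data.List.Membership.Propositional as List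
open import Data.List.Membership.Propositional.Properties using (∈-tabulate⁺)
open import Data.List.Relation.Unary.All as All using ()
open import Data.List.Relation.Unary.All.Properties using (tabulate⁺)
open import Data.List.Relation.Unary.Any using (here; there)
open import Data.Nat.Base using (ℕ; _≤_; z≤n)
open import Data.Nat.Properties using (≤-<-trans; ≤-antisym)
open import Data.Product using (∃; ∃-syntax; _×_; _,_; proj₁; proj₂)
open import Data.Sum.Base using (inj₁; inj₂)
open import Data.Vec.Base as Vec using ([]; _∷_; here; there)
open import Data.Vec.Properties using ([]=⇒lookup; lookup⇒[]=; lookup∘tabulate)
open import Data.Vec.Properties.WithK using ([]=-irrelevant)
open import Function.Base using (_∘_)
open import Function.Bundles using (mk↔ₛ′; module Bijection; module Equivalence)
open import Function.Properties.Inverse using (↔⇒⤖)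
open import Relation.Binary.Definitions using (Symmetric)
open import Relation.Binary.PropositionalEquality
  using (_≡_; refl; sym; trans; cong; subst; subst₂)
open import Relation.Nullary using (yes; no; contradiction)

-- Induction on `p`: when the head is in `p`, its value `y` is deleted from `q`, and the tail still
-- injects into the strictly smaller `q - y`.
injection⇒∣p∣≤∣q∣ : ∀ {m n} (p : Subset m) (q : Subset n)
  (f : ∀ {x} → x ∈ p → ∃ (_∈ q)) →
  (∀ {x y} (x∈p : x ∈ p) (y∈p : y ∈ p) → proj₁ (f x∈p) ≡ proj₁ (f y∈p) → x ≡ y) →
  ∣ p ∣ ≤ ∣ q ∣
injection⇒∣p∣≤∣q∣ [] q f f-inj = z≤n
injection⇒∣p∣≤∣q∣ (outside ∷ p) q f f-inj =
  injection⇒∣p∣≤∣q∣ p q (f ∘ there)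
    λ x∈p y∈p eq → suc-injective (f-inj (there x∈p) (there y∈p) eq)
injection⇒∣p∣≤∣q∣ (inside ∷ p) q f f-inj =
  ≤-<-trans
    (injection⇒∣p∣≤∣q∣ p (q - y) f′
      λ x∈p y∈p eq → suc-injective (f-inj (there x∈p) (there y∈p) eq))
    (x∈p⇒∣p-x∣<∣p∣ y∈q)
  where
  y = proj₁ (f here)
  y∈q = proj₂ (f here)
  f′ : ∀ {x} → x ∈ p → ∃ (_∈ (q - y))
  f′ x∈p = proj₁ (f (there x∈p)) ,
    x∈p∧x≢y⇒x∈p-y (proj₂ (f (there x∈p)))
      -- A tail element also sent to `y` would, by injectivity, equal the head: a successor equal to
      -- zero.
      λ eq → contradiction (f-inj (there x∈p) here eq) λ ()

∃∈-≡ : ∀ {n} {p : Subset n} {a b : ∃ (_∈ p)} → proj₁ a ≡ proj₁ b → a ≡ b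
∃∈-≡ {a = x , x∈p} {b = _ , x∈p′} refl = cong (x ,_) ([]=-irrelevant x∈p x∈p′)

-- A subset is its characteristic vector, so the image is the pullback along the inverse
-- permutation.
image : ∀ {n} → Permutation′ n → Subset n → Subset n
image π p = Vec.tabulate λ x → Vec.lookup p (π ⟨$⟩ˡ x)

∈-image⁺ : ∀ {n} (π : Permutation′ n) {p : Subset n} {x} → x ∈ p → π ⟨$⟩ʳ x ∈ image π p
∈-image⁺ π {p} {x} x∈p = lookup⇒[]= _ _
  (trans (lookup∘tabulate _ (π ⟨$⟩ʳ x))
    (trans (cong (Vec.lookup p) (inverseˡ π)) ([]=⇒lookup x∈p)))

∈-image⁻ : ∀ {n} (π : Permutation′ n) {p : Subset n} {x} → x ∈ image π p → π ⟨$⟩ˡ x ∈ p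
∈-image⁻ π {p} {x} x∈πp = lookup⇒[]= _ _
  (trans (sym (lookup∘tabulate _ x)) ([]=⇒lookup x∈πp))

module _ {n : ℕ} (Γ : Graph n) where
  open Graph Γ using (Adj) renaming (sym to adj-sym)

  dominates-sym : Symmetric (Dominates Γ)
  dominates-sym (inj₁ eq)  = inj₁ (sym eq)
  dominates-sym (inj₂ adj) = inj₂ (adj-sym adj)

  efficient⇒dominating : ∀ {D} → IsEfficientDominatingSet Γ D → IsDominatingSet Γ D
  efficient⇒dominating eff w = let u , u-dom , _ = eff w in u , u-dom

  efficient-unique : ∀ {D} → IsEfficientDominatingSet Γ D → ∀ {u v w} →
    u ∈ D → v ∈ D → Dominates Γ u w → Dominates Γ v w → u ≡ v
  efficient-unique eff {w = w} u∈D v∈D u-dom v-dom =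
    let _ , _ , unique = eff w in
    trans (sym (unique (u∈D , u-dom))) (unique (v∈D , v-dom))

  efficient-minimum : ∀ {D E} → IsEfficientDominatingSet Γ D → IsDominatingSet Γ E →
    ∣ D ∣ ≤ ∣ E ∣
  efficient-minimum {D} {E} eff dom = injection⇒∣p∣≤∣q∣ D E
    (λ {x} _ → let u , u∈E , _ = dom x in u , u∈E)
    λ {x} {y} x∈D y∈D eq →
      -- By symmetry `x` and `y` both dominate the vertex of `E` chosen for them, so efficiency of
      -- `D` identifies them.
      let _ , _ , ux = dom x ; _ , _ , uy = dom y in
      efficient-unique eff x∈D y∈D (dominates-sym ux)
        (subst (Dominates Γ y) (sym eq) (dominates-sym uy))

  efficient-reconfigure : ∀ {D E} →
    IsEfficientDominatingSet Γ D → IsEfficientDominatingSet Γ E → CanReconfigure Γ D E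
  efficient-reconfigure {D} {E} effD effE =
    ↔⇒⤖ (mk↔ₛ′ (guard effE) (guard effD) (guard-inverse effD effE) (guard-inverse effE effD)) ,
    -- A legal move from `d` to `u` says that `d` dominates `u`; `effE` gives the converse
    -- direction.
    λ (d , _) → let _ , (_ , dom) , _ = effE d in dominates-sym dom
    where
    guard : ∀ {A B} → IsEfficientDominatingSet Γ B → ∃ (_∈ A) → ∃ (_∈ B)
    guard eff (x , _) = let u , (u∈B , _) , _ = eff x in u , u∈B

    -- If `u` is the dominator of `x` in `A`, then `x` dominates `u` and lies in `B`, so it is the
    -- unique dominator of `u` there.
    guard-inverse : ∀ {A B} (effA : IsEfficientDominatingSet Γ A)
      (effB : IsEfficientDominatingSet Γ B) (b : ∃ (_∈ B)) →
      guard effB (guard {B} effA b) ≡ b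
    guard-inverse effA effB (x , x∈B) =
      let u , (_ , u-dom) , _ = effA x ; _ , _ , unique = effB u in
      ∃∈-≡ (unique (x∈B , dominates-sym u-dom))

  -- An attack on an unguarded `w` brings some guard to `w` in one move, so that guard started at a
  -- vertex dominating `w`.
  eternal⇒dominating : ∀ {D} → IsEternalDominatingSet Γ D → IsDominatingSet Γ D
  eternal⇒dominating {D} (𝒟 , conf , D∈𝒟) w with w ∈? D
  ... | yes w∈D = w , w∈D , inj₁ refl
  ... | no  w∉D =
    let E , _ , w∈E , f , moves = IsEternalDominatingConfiguration.defends conf D∈𝒟 w∉D
        d , fd≡w = Bijection.strictlySurjective f (w , w∈E)
    in proj₁ d , proj₂ d , subst (Dominates Γ (proj₁ d)) (cong proj₁ fd≡w) (moves d)

  automorphism-dominates : ∀ π → IsAutomorphism Γ π → ∀ {u v} →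
    Dominates Γ u v → Dominates Γ (π ⟨$⟩ʳ u) (π ⟨$⟩ʳ v)
  automorphism-dominates π aut (inj₁ eq)  = inj₁ (cong (π ⟨$⟩ʳ_) eq)
  automorphism-dominates π aut (inj₂ adj) = inj₂ (Equivalence.to (aut _ _) adj)

  automorphism-dominates⁻ : ∀ π → IsAutomorphism Γ π → ∀ {u v} →
    Dominates Γ (π ⟨$⟩ʳ u) (π ⟨$⟩ʳ v) → Dominates Γ u v
  automorphism-dominates⁻ π aut (inj₁ eq)  =
    inj₁ (trans (sym (inverseˡ π)) (trans (cong (π ⟨$⟩ˡ_) eq) (inverseˡ π)))
  automorphism-dominates⁻ π aut (inj₂ adj) = inj₂ (Equivalence.from (aut _ _) adj)

  -- Unique domination of `w` by the image is unique domination of its preimage by `D`, carried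
  -- along `π`.
  image-efficient : ∀ π → IsAutomorphism Γ π → ∀ {D} →
    IsEfficientDominatingSet Γ D → IsEfficientDominatingSet Γ (image π D)
  image-efficient π aut eff w =
    let u , (u∈D , u-dom) , unique = eff (π ⟨$⟩ˡ w) in
    π ⟨$⟩ʳ u ,
    (∈-image⁺ π u∈D ,
     subst (Dominates Γ (π ⟨$⟩ʳ u)) (inverseʳ π) (automorphism-dominates π aut u-dom)) ,
    λ {v} (v∈πD , v-dom) →
      trans
        (cong (π ⟨$⟩ʳ_) (unique
          (∈-image⁻ π v∈πD ,
           automorphism-dominates⁻ π aut
             (subst₂ (Dominates Γ) (sym (inverseʳ π)) (sym (inverseʳ π)) v-dom))))
        (inverseʳ π)

  efficient-through : VertexTransitive Γ → ∃ (IsEfficientDominatingSet Γ) →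
    ∀ w → ∃[ E ] (IsEfficientDominatingSet Γ E × w ∈ E)
  efficient-through transitive (D , eff) w =
    -- Any element of `D` can be carried to `w`; the dominator of `w` supplies one.
    let u , (u∈D , _) , _ = eff w
        π , aut , πu≡w = transitive u w
    in image π D , image-efficient π aut eff , subst (_∈ image π D) πu≡w (∈-image⁺ π u∈D)

  efficient⇒eternal : VertexTransitive Γ → ∀ {D} →
    IsEfficientDominatingSet Γ D → IsEternalDominatingSet Γ D
  efficient⇒eternal transitive {D} eff = 𝒟 , conf , here refl
    where
    through : ∀ w → ∃[ E ] (IsEfficientDominatingSet Γ E × w ∈ E)
    through = efficient-through transitive (D , eff)

    𝒟 : List (Subset n)
    -- One efficient set through each vertex, with `D` in front so that it is itself a member.
    𝒟 = D List.∷ List.tabulate (proj₁ ∘ through)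

    𝒟-efficient : ∀ {E} → E List.∈ 𝒟 → IsEfficientDominatingSet Γ E
    𝒟-efficient = All.lookup (eff All.∷ tabulate⁺ (proj₁ ∘ proj₂ ∘ through))

    conf : IsEternalDominatingConfiguration Γ 𝒟
    conf = record
      { nonempty        = D , here refl
      ; sameCardinality = λ A∈𝒟 B∈𝒟 →
          let effA = 𝒟-efficient A∈𝒟 ; effB = 𝒟-efficient B∈𝒟 in
          -- Each of the two sets is both efficient and dominating, so each is minimum against the
          -- other.
          ≤-antisym (efficient-minimum effA (efficient⇒dominating effB))
                    (efficient-minimum effB (efficient⇒dominating effA))
      ; defends         = λ A∈𝒟 {w} _ →
          -- The reply is chosen from `w` alone, since every efficient set reconfigures to every
          -- other.
          let E , effE , w∈E = through w in
          E , there (∈-tabulate⁺ w) , w∈E , efficient-reconfigure (𝒟-efficient A∈𝒟) effE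
      }

corollary2p2 : (n : ℕ) (Γ : Graph n) → VertexTransitive Γ →
    ∃ (IsEfficientDominatingSet Γ) →
    ∃[ k ] (IsEternalDominationNumber Γ k × IsDominationNumber Γ k)
corollary2p2 n Γ transitive (D , eff) =
  ∣ D ∣ ,
  ((D , efficient⇒eternal Γ transitive eff , refl) ,
   λ E eternal → efficient-minimum Γ eff (eternal⇒dominating Γ eternal)) ,
  ((D , efficient⇒dominating Γ eff , refl) ,
   λ E dom → efficient-minimum Γ eff dom)
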